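{- Let $k\ge 3$, $1\le \ell<k/2$ and $1\le d\le k-1$ be integers. For every $n$ with $(k-\ell)\mid n$ there exists an $n$-vertex $k$-graph $H_0$ with $$\delta_d(H_0)\ge \left(1-\left(1-\frac{1}{2(k-\ell)}\right)^{k-d}-o(1)\right)\binom{n}{k-d}$$ containing no Hamilton $\ell$-cycle, where $o(1)$ denotes a quantity depending only on $k,\ell,d,n$ that tends to $0$ as $n\to\infty$ (with $k,\ell,d$ fixed). In other words, $$h_d^\ell(k)\ge 1-\left(1-\frac{1}{2(k-\ell)}\right)^{k-d}.$$
   Context: A $k$-graph $H=(V,E)$ consists of a finite vertex set $V$ and a family $E$ of $k$-element subsets of $V$. For a $d$-set $S\subseteq V$, $\deg_H(S)$ is the number of $(k-d)$-sets $T\subseteq V$ with $T\cup S\in E$, and $\delta_d(H)$ is the minimum of $\deg_H(S)$ over all $d$-sets $S\subseteq V$. For $1\le \ell<k$, a $k$-graph is an $\ell$-cycle if there is a cyclic ordering of its vertices such that every edge consists of $k$ consecutive vertices and any two consecutive edges share exactly $\ell$ vertices (so an $\ell$-cycle on $n$ vertices has exactly $n/(k-\ell)$ edges, and every vertex is in an edge). A $k$-graph on $n$ vertices contains a Hamilton $\ell$-cycle if it contains an $\ell$-cycle as a spanning subhypergraph; this requires $(k-\ell)\mid n$. $h_d^\ell(k,n)$ is the smallest integer $h$ such that every $n$-vertex $k$-graph $H$ with $\delta_d(H)\ge h$ contains a Hamilton $\ell$-cycle, and $$h_d^\ell(k):=\limsup_{n\to\infty}\frac{h_d^\ell(k,n)}{\binom{n}{k-d}},$$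 where $n$ ranges over multiples of $k-\ell$. -}

module Defs where

open import Algebra.Definitions.RawSemiring using () renaming (_^_ to pow)
open import Data.Bool.Base using (Bool; T)
open import Data.Fin.Base as Fin using (Fin; toℕ)
open import Data.Fin.Permutation using (Permutation′; _⟨$⟩ʳ_)
open import Data.Fin.Subset using (Subset; inside; outside; ⁅_⁆; ⋃; ∣_∣; _∈_; _∪_; _∩_)
open import Data.Integer.Base using (+_)
open import Data.List.Base using (List; []; _∷_; _++_; map; filter; filterᵇ; length; upTo)
open import Data.List.Extrema.Nat using (min)
open import Data.Nat.Base using (ℕ; zero; suc; _+_; _*_; _∸_; _≤_; _<_)
open import Data.Nat.Combinatorics using (_C_)
open import Data.Nat.DivMod using (_mod_)
import Data.Nat.Properties as ℕ
open import Data.Product.Base using (Σ; ∃; _×_)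
open import Data.Rational.Base as ℚ using (ℚ; 0ℚ)
import Data.Vec.Base as Vec
open import Function.Bundles using (_⇔_)
open import Relation.Binary.PropositionalEquality.Core using (_≡_)

private
  variable
    k n : ℕ

-- The vertex set of an n-vertex graph is Fin n.
record KGraph (k n : ℕ) : Set where
  field
    edge    : Subset n → Bool
    uniform : ∀ S → T (edge S) → ∣ S ∣ ≡ k

  Edge : Subset n → Set
  Edge S = T (edge S)

open KGraph public

subsets : ∀ n → List (Subset n)
subsets zero    = Vec.[] ∷ []
subsets (suc n) = map (outside Vec.∷_) (subsets n) ++ map (inside Vec.∷_) (subsets n)

subsetsOfSize : ℕ → ∀ n → List (Subset n)
subsetsOfSize d n = filter (λ S → ∣ S ∣ ℕ.≟ d) (subsets n)

deg : KGraph k n → Subset n → ℕ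
deg {k} {n} H S = length (filterᵇ (λ R → edge H (R ∪ S)) (subsetsOfSize (k ∸ ∣ S ∣) n))

-- The default value n C (k ∸ d) bounds every degree in the list, so it only
-- matters when n < d, where it is the value of a minimum over no d-sets.
δ : ℕ → KGraph k n → ℕ
δ {k} {n} d H = min (n C (k ∸ d)) (map (deg H) (subsetsOfSize d n))

-- Addition modulo n.
_⊕_ : Fin n → ℕ → Fin n
_⊕_ {suc n} i t = (toℕ i + t) mod (suc n)

-- The k consecutive vertices from position p onwards in the cyclic ordering
-- in which vertex (order ⟨$⟩ʳ i) has position i.
arc : ℕ → Permutation′ n → Fin n → Subset n
arc k order p = ⋃ (map (λ t → ⁅ order ⟨$⟩ʳ (p ⊕ t) ⁆) (upTo k))

-- The edges are listed in their cyclic order, by the increasing positions at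
-- which they start; the edge after the last one is the first one.  A cycle is
-- required to have an edge, which excludes only the graph without vertices.
record IsCycle (ℓ : ℕ) (G : KGraph k n) : Set where
  field
    order      : Permutation′ n
    m          : ℕ
    nonempty   : 0 < m
    start      : Fin m → Fin n
    increasing : ∀ {i j} → i Fin.< j → start i Fin.< start j
    edges      : ∀ S → Edge G S ⇔ (∃ λ j → S ≡ arc k order (start j))
    sharing    : ∀ j → ∣ arc k order (start j) ∩ arc k order (start (j ⊕ 1)) ∣ ≡ ℓ
    edgeCount  : m * (k ∸ ℓ) ≡ n
    covering   : ∀ v → ∃ λ S → Edge G S × v ∈ S

HasHamiltonCycle : ℕ → KGraph k n → Set
HasHamiltonCycle {k} {n} ℓ H =
  Σ (KGraph k n) λ G → IsCycle ℓ G × (∀ S → Edge G S → Edge H S)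

ForcesHamiltonCycle : (k ℓ d n h : ℕ) → Set
ForcesHamiltonCycle k ℓ d n h =
  (H : KGraph k n) → h ≤ δ d H → HasHamiltonCycle ℓ H

-- h is the number h_d^ℓ(k,n).
IsThreshold : (k ℓ d n h : ℕ) → Set
IsThreshold k ℓ d n h =
  ForcesHamiltonCycle k ℓ d n h × (∀ h′ → ForcesHamiltonCycle k ℓ d n h′ → h ≤ h′)

ratio : ℕ → ℕ → ℚ
ratio a zero    = 0ℚ
ratio a (suc b) = + a ℚ./ suc b

fromℕ : ℕ → ℚ
fromℕ a = + a ℚ./ 1

infixr 8 _^_
_^_ : ℚ → ℕ → ℚ
_^_ = pow ℚ.+-*-rawSemiring

TendsToZero : (ℕ → ℚ) → Set
TendsToZero f = ∀ ε → 0ℚ ℚ.< ε → ∃ λ N → ∀ n → N ≤ n → ℚ.∣ f n ∣ ℚ.< ε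

-- q is at most the limsup of f n as n tends to infinity through P, that is,
-- at most the supremum of f over every tail of P.
LimsupAtLeast : (P : ℕ → Set) (f : ℕ → ℚ) (q : ℚ) → Set
LimsupAtLeast P f q =
  ∀ N ε → 0ℚ ℚ.< ε → ∃ λ n → N ≤ n × P n × (q ℚ.- ε) ℚ.< f n

-- 1 - (1 - 1/(2(k-ℓ)))^(k-d)
bound : (k ℓ d : ℕ) → ℚ
bound k ℓ d = ℚ.1ℚ ℚ.- (ℚ.1ℚ ℚ.- ratio 1 (2 * (k ∸ ℓ))) ^ (k ∸ d)

module Submission where

-- Fix a set A of about n/(2(k-ℓ)) vertices and let H₀ consist of all k-sets meeting A.
-- Consecutive edges of a Hamilton ℓ-cycle start at least k-ℓ positions apart, and
-- k < 2(k-ℓ), so every second edge of the cycle gives ⌊n/(2(k-ℓ))⌋ disjoint edges, each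
-- of which needs its own vertex of A; this is impossible when A is smaller than that.
-- On the other hand a d-set S has degree at least C(n-d,r) - C(n-|A|,r), where r = k-d,
-- and C(n-|A|,r) / C(n,r) ≤ (1-|A|/n)^r, which tends to (1-1/(2(k-ℓ)))^r.

open import Defs hiding (_^_)
open import Data.Bool.Base using (Bool; true; false; T; _∧_)
open import Data.Bool.Properties using (T-∧; ∧-zeroʳ)
open import Data.Fin.Base as Fin using (Fin; toℕ; fromℕ<)
open import Data.Fin.Permutation using (Permutation′; _⟨$⟩ʳ_)
open import Data.Fin.Properties using (toℕ-fromℕ<; toℕ-injective; toℕ<n; nonZeroIndex; pigeonhole)
open import Data.Fin.Subset using (Subset; inside; outside; ∣_∣; _∩_; _∪_; ⊥; ⁅_⁆; ⋃; _∈_; Nonempty)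
open import Data.Fin.Subset.Properties
import Data.Integer.Base as ℤ
import Data.Integer.Properties as ℤ
open import Data.List.Base using (List; []; _∷_; _++_; map; filter; filterᵇ; length; upTo)
open import Data.List.Extrema.Nat using (v≤min⁺)
open import Data.List.Membership.Propositional using () renaming (_∈_ to _∈ₗ_)
open import Data.List.Membership.Propositional.Properties using (∈-map⁺; ∈-map⁻; ∈-upTo⁺; ∈-upTo⁻)
open import Data.List.Properties using (length-upTo)
open import Data.List.Relation.Unary.All as All using (All)
import Data.List.Relation.Unary.All.Properties as All
open import Data.List.Relation.Unary.Any using (here; there)
open import Data.Nat.Base
open import Data.Nat.Combinatorics using (_C_; nC1≡n; nCn≡1; k>n⇒nCk≡0; nCk+nC[k+1]≡[n+1]C[k+1])
open import Data.Nat.Divisibility using (_∣_; divides)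
open import Data.Nat.DivMod
open import Data.Nat.Properties
open import Data.Nat.Tactic.RingSolver using (solve-∀)
open import Data.Product.Base using (Σ; ∃; _×_; _,_; proj₁; proj₂)
open import Data.Rational.Base as ℚ using (ℚ; 0ℚ; 1ℚ; toℚᵘ; mkℚ)
import Data.Rational.Properties as ℚ
open import Data.Rational.Solver using (module +-*-Solver)
open import Data.Rational.Unnormalised.Base as ℚᵘ using (mkℚᵘ; *≡*; *≤*; *<*)
import Data.Rational.Unnormalised.Properties as ℚᵘ
open import Data.Sum.Base using (_⊎_; inj₁; inj₂)
import Data.Vec.Base as Vec
open import Function.Base using (_∘_)
open import Function.Bundles using (Equivalence; Injection)
open import Function.Properties.Inverse using (↔⇒↣)
open import Relation.Binary.PropositionalEquality
open import Relation.Nullary using (¬_; does; contradiction; yes; no)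
open import Relation.Nullary.Decidable using (⌊_⌋; toWitness; fromWitness)
open import Relation.Unary using (Decidable)

-- With M = 2(k-ℓ) and q = ⌊n/M⌋, the set A has `q ∸ 1` vertices, one fewer than the q disjoint
-- edges. If q = 0, the truncated subtraction leaves A empty; then H₀ has no edge, whereas a cycle
-- must have one, so small n also admit no Hamilton cycle. The rounding gives M|A| ≥ n - 2M, hence
-- 1-|A|/n exceeds 1-1/M by at most 2/n. Taking r-th powers multiplies this error by r, and
-- comparing C(n-d,r) with C(n,r) costs another dr/n. This is the origin of the explicit error o(n)
-- = (d+2)r/n. The estimates are made in ℕ with the denominators n and M^r cleared, where `M′` = M-1
-- is the numerator of 1-1/M. Rational numbers enter only when the finished inequality is divided by
-- n M^r.

private
  variable
    X Y : Set

-- Binomial coefficients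

0C[1+k]≡0 : ∀ k → 0 C suc k ≡ 0
0C[1+k]≡0 k = k>n⇒nCk≡0 {0} {suc k} z<s

-- The absorption identity (k+1)C(n,k+1) = (n-k)C(n,k), with k C(n,k) moved to the left so that no
-- truncated subtraction obstructs the induction by Pascal's rule.
[1+k]*nC[1+k]+k*nCk≡n*nCk : ∀ n k → suc k * (n C suc k) + k * (n C k) ≡ n * (n C k)
[1+k]*nC[1+k]+k*nCk≡n*nCk n zero = trans (solve₀ (n C 1)) (trans (nC1≡n n) (sym (*-identityʳ n)))
  where
  solve₀ : ∀ x → 1 * x + 0 * 1 ≡ x
  solve₀ = solve-∀
[1+k]*nC[1+k]+k*nCk≡n*nCk zero (suc k)
  rewrite 0C[1+k]≡0 k | 0C[1+k]≡0 (suc k) | *-zeroʳ k = refl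
[1+k]*nC[1+k]+k*nCk≡n*nCk (suc n) (suc k) = begin
  (2 + k) * (suc n C (2 + k)) + suc k * (suc n C suc k)
    ≡⟨ cong₂ (λ x y → (2 + k) * x + suc k * y)
         (sym (nCk+nC[k+1]≡[n+1]C[k+1] n (suc k))) (sym (nCk+nC[k+1]≡[n+1]C[k+1] n k)) ⟩
  (2 + k) * (b + c) + suc k * (a + b)
    ≡⟨ regroup k a b c ⟩
  ((2 + k) * c + suc k * b) + (suc k * b + k * a) + (a + b)
    ≡⟨ cong₂ (λ x y → x + y + (a + b))
         ([1+k]*nC[1+k]+k*nCk≡n*nCk n (suc k)) ([1+k]*nC[1+k]+k*nCk≡n*nCk n k) ⟩
  n * b + n * a + (a + b)
    ≡⟨ collect n a b ⟩
  suc n * (a + b)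
    ≡⟨ cong (suc n *_) (nCk+nC[k+1]≡[n+1]C[k+1] n k) ⟩
  suc n * (suc n C suc k) ∎
  where
  open ≡-Reasoning
  a = n C k
  b = n C suc k
  c = n C (2 + k)
  regroup : ∀ k a b c → (2 + k) * (b + c) + suc k * (a + b)
                      ≡ ((2 + k) * c + suc k * b) + (suc k * b + k * a) + (a + b)
  regroup = solve-∀
  collect : ∀ n a b → n * b + n * a + (a + b) ≡ suc n * (a + b)
  collect = solve-∀

[1+k]*nC[1+k]≡[n∸k]*nCk : ∀ n k → suc k * (n C suc k) ≡ (n ∸ k) * (n C k)
[1+k]*nC[1+k]≡[n∸k]*nCk n k = begin
  suc k * (n C suc k)                                     ≡⟨ sym (m+n∸n≡m _ (k * (n C k))) ⟩
  suc k * (n C suc k) + k * (n C k) ∸ k * (n C k)         ≡⟨ cong (_∸ k * (n C k)) ([1+k]*nC[1+k]+k*nCk≡n*nCk n k) ⟩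
  n * (n C k) ∸ k * (n C k)                               ≡⟨ sym (*-distribʳ-∸ (n C k) n k) ⟩
  (n ∸ k) * (n C k)                                       ∎
  where open ≡-Reasoning

[1+k]*[1+n]C[1+k]≡[1+n]*nCk : ∀ n k → suc k * (suc n C suc k) ≡ suc n * (n C k)
[1+k]*[1+n]C[1+k]≡[1+n]*nCk n k = begin
  suc k * (suc n C suc k)                       ≡⟨ cong (suc k *_) (sym (nCk+nC[k+1]≡[n+1]C[k+1] n k)) ⟩
  suc k * (n C k + n C suc k)                   ≡⟨ regroup k (n C k) (n C suc k) ⟩
  n C k + (suc k * (n C suc k) + k * (n C k))   ≡⟨ cong (n C k +_) ([1+k]*nC[1+k]+k*nCk≡n*nCk n k) ⟩
  suc n * (n C k)                               ∎
  where
  open ≡-Reasoning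
  regroup : ∀ k a b → suc k * (a + b) ≡ a + (suc k * b + k * a)
  regroup = solve-∀

nCk≤[1+n]Ck : ∀ n k → n C k ≤ suc n C k
nCk≤[1+n]Ck n zero    = ≤-refl
nCk≤[1+n]Ck n (suc k) = subst (n C suc k ≤_) (nCk+nC[k+1]≡[n+1]C[k+1] n k) (m≤n+m _ _)

C-monoˡ-≤ : ∀ {m n} k → m ≤ n → m C k ≤ n C k
C-monoˡ-≤ {m} k m≤n = go (≤⇒≤′ m≤n)
  where
  go : ∀ {n} → m ≤′ n → m C k ≤ n C k
  go (≤′-reflexive refl) = ≤-refl
  go (≤′-step {n} p)   = ≤-trans (go p) (nCk≤[1+n]Ck n k)

-- d * (n C r) bounds the number of (1 + r)-subsets of a (1 + n)-set meeting a given d-set.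
[1+n]C[1+r]≤[1+n∸d]C[1+r]+d*nCr : ∀ n r d →
  suc n C suc r ≤ (suc n ∸ d) C suc r + d * (n C r)
[1+n]C[1+r]≤[1+n∸d]C[1+r]+d*nCr n r zero = m≤m+n _ _
[1+n]C[1+r]≤[1+n∸d]C[1+r]+d*nCr n r (suc d) = begin
  suc n C suc r                                      ≤⟨ [1+n]C[1+r]≤[1+n∸d]C[1+r]+d*nCr n r d ⟩
  (suc n ∸ d) C suc r + d * (n C r)                  ≤⟨ +-monoˡ-≤ _ (step (≤-total d n)) ⟩
  (n ∸ d) C suc r + n C r + d * (n C r)              ≡⟨ +-assoc ((n ∸ d) C suc r) _ _ ⟩
  (n ∸ d) C suc r + (n C r + d * (n C r))            ∎
  where
  open ≤-Reasoning
  step : d ≤ n ⊎ n ≤ d → (suc n ∸ d) C suc r ≤ (n ∸ d) C suc r + n C r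
  step (inj₁ d≤n) = begin
    (suc n ∸ d) C suc r                  ≡⟨ cong (_C suc r) (+-∸-assoc 1 d≤n) ⟩
    suc (n ∸ d) C suc r                  ≡⟨ sym (nCk+nC[k+1]≡[n+1]C[k+1] (n ∸ d) r) ⟩
    (n ∸ d) C r + (n ∸ d) C suc r        ≤⟨ +-monoˡ-≤ _ (C-monoˡ-≤ r (m∸n≤m n d)) ⟩
    n C r + (n ∸ d) C suc r              ≡⟨ +-comm (n C r) _ ⟩
    (n ∸ d) C suc r + n C r              ∎
  step (inj₂ n≤d) with m≤n⇒m<n∨m≡n n≤d
  ... | inj₁ n<d  = ≤-trans (≤-reflexive (cong (_C suc r) (trans (m≤n⇒m∸n≡0 n<d) (sym (m≤n⇒m∸n≡0 n≤d))))) (m≤m+n _ _)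
  ... | inj₂ refl = step (inj₁ ≤-refl)

-- The loss d C(n-1,r-1), multiplied by n, becomes d r C(n,r) by absorption. So replacing n by n-d
-- changes the binomial coefficient by a relative error of at most dr/n.
n*nCr≤n*[n∸d]Cr+d*r*nCr : ∀ n r d → n * (n C r) ≤ n * ((n ∸ d) C r) + d * r * (n C r)
n*nCr≤n*[n∸d]Cr+d*r*nCr n       zero    d = m≤m+n _ _
n*nCr≤n*[n∸d]Cr+d*r*nCr zero    (suc r) d = z≤n
n*nCr≤n*[n∸d]Cr+d*r*nCr (suc n) (suc r) d = begin
  suc n * (suc n C suc r)
    ≤⟨ *-monoʳ-≤ (suc n) ([1+n]C[1+r]≤[1+n∸d]C[1+r]+d*nCr n r d) ⟩
  suc n * ((suc n ∸ d) C suc r + d * (n C r))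
    ≡⟨ regroup (suc n) _ d (n C r) ⟩
  suc n * ((suc n ∸ d) C suc r) + d * (suc n * (n C r))
    ≡⟨ cong (λ x → suc n * ((suc n ∸ d) C suc r) + d * x) (sym ([1+k]*[1+n]C[1+k]≡[1+n]*nCk n r)) ⟩
  suc n * ((suc n ∸ d) C suc r) + d * (suc r * (suc n C suc r))
    ≡⟨ cong (suc n * ((suc n ∸ d) C suc r) +_) (sym (*-assoc d (suc r) _)) ⟩
  suc n * ((suc n ∸ d) C suc r) + d * suc r * (suc n C suc r) ∎
  where
  open ≤-Reasoning
  regroup : ∀ n a d b → n * (a + d * b) ≡ n * a + d * (n * b)
  regroup = solve-∀

-- C(p,r)/C(n,r) is the product of the factors (p-i)/(n-i) for i < r, and each is at most p/n
-- because p ≤ n.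
pCr*n^r≤p^r*nCr : ∀ {p n} r → p ≤ n → (p C r) * n ^ r ≤ p ^ r * (n C r)
pCr*n^r≤p^r*nCr zero p≤n = ≤-refl
pCr*n^r≤p^r*nCr {p} {n} (suc r) p≤n = *-cancelˡ-≤ (suc r) (begin
  suc r * ((p C suc r) * (n * n ^ r))
    ≡⟨ regroup₁ (suc r) (p C suc r) n (n ^ r) ⟩
  (suc r * (p C suc r)) * n ^ r * n
    ≡⟨ cong (λ x → x * n ^ r * n) ([1+k]*nC[1+k]≡[n∸k]*nCk p r) ⟩
  ((p ∸ r) * (p C r)) * n ^ r * n
    ≡⟨ regroup₂ (p ∸ r) (p C r) (n ^ r) n ⟩
  ((p C r) * n ^ r) * ((p ∸ r) * n)
    ≤⟨ *-mono-≤ (pCr*n^r≤p^r*nCr r p≤n) cross ⟩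
  (p ^ r * (n C r)) * ((n ∸ r) * p)
    ≡⟨ regroup₃ (p ^ r) (n C r) (n ∸ r) p ⟩
  p * p ^ r * ((n ∸ r) * (n C r))
    ≡⟨ cong (p * p ^ r *_) (sym ([1+k]*nC[1+k]≡[n∸k]*nCk n r)) ⟩
  p * p ^ r * (suc r * (n C suc r))
    ≡⟨ regroup₄ (p * p ^ r) (suc r) (n C suc r) ⟩
  suc r * (p * p ^ r * (n C suc r)) ∎)
  where
  open ≤-Reasoning
  -- Multiplication distributes over truncated subtraction, so r may exceed p or n here.
  cross : (p ∸ r) * n ≤ (n ∸ r) * p
  cross = begin
    (p ∸ r) * n     ≡⟨ *-distribʳ-∸ n p r ⟩
    p * n ∸ r * n   ≤⟨ ∸-monoʳ-≤ (p * n) (*-monoʳ-≤ r p≤n) ⟩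
    p * n ∸ r * p   ≡⟨ cong (_∸ r * p) (*-comm p n) ⟩
    n * p ∸ r * p   ≡⟨ sym (*-distribʳ-∸ p n r) ⟩
    (n ∸ r) * p     ∎
  regroup₁ : ∀ s a n m → s * (a * (n * m)) ≡ (s * a) * m * n
  regroup₁ = solve-∀
  regroup₂ : ∀ q a m n → (q * a) * m * n ≡ (a * m) * (q * n)
  regroup₂ = solve-∀
  regroup₃ : ∀ m a q p → (m * a) * (q * p) ≡ p * m * (q * a)
  regroup₃ = solve-∀
  regroup₄ : ∀ m s a → m * (s * a) ≡ s * (m * a)
  regroup₄ = solve-∀

-- Each factor y exceeds x by at most c * M, and all other factors are at most w = M * n;
-- the extra factor n on the left saves dividing w by it.
y^r*n≤x^r*n+r*c*w^r : ∀ M n c {x y} r → y ≤ x + c * M → y ≤ M * n → x ≤ M * n →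
  y ^ r * n ≤ x ^ r * n + r * c * (M * n) ^ r
y^r*n≤x^r*n+r*c*w^r M n c zero y≤x+cM y≤w x≤w = m≤m+n _ _
y^r*n≤x^r*n+r*c*w^r M n c {x} {y} (suc r) y≤x+cM y≤w x≤w = begin
  y * y ^ r * n
    ≡⟨ *-assoc y _ n ⟩
  y * (y ^ r * n)
    ≤⟨ *-monoʳ-≤ y (y^r*n≤x^r*n+r*c*w^r M n c r y≤x+cM y≤w x≤w) ⟩
  y * (x ^ r * n + r * c * w ^ r)
    ≡⟨ *-distribˡ-+ y _ _ ⟩
  y * (x ^ r * n) + y * (r * c * w ^ r)
    ≤⟨ +-mono-≤ (*-monoˡ-≤ (x ^ r * n) y≤x+cM) (*-monoˡ-≤ (r * c * w ^ r) y≤w) ⟩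
  (x + c * M) * (x ^ r * n) + w * (r * c * w ^ r)
    ≡⟨ regroup x c M (x ^ r) n r (w ^ r) ⟩
  x * x ^ r * n + (c * w * x ^ r + r * c * (w * w ^ r))
    ≤⟨ +-monoʳ-≤ (x * x ^ r * n) (+-monoˡ-≤ _ (*-monoʳ-≤ (c * w) (^-monoˡ-≤ r x≤w))) ⟩
  x * x ^ r * n + (c * w * w ^ r + r * c * (w * w ^ r))
    ≡⟨ cong (x * x ^ r * n +_) (collect c w (w ^ r) r) ⟩
  x * x ^ r * n + suc r * c * (w * w ^ r) ∎
  where
  open ≤-Reasoning
  w = M * n
  regroup : ∀ x c M a n r b → (x + c * M) * (a * n) + M * n * (r * c * b)
                            ≡ x * a * n + (c * (M * n) * a + r * c * (M * n * b))
  regroup = solve-∀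
  collect : ∀ c w b r → c * w * b + r * c * (w * b) ≡ suc r * c * (w * b)
  collect = solve-∀

nCk>0 : ∀ {n k} → k ≤ n → 0 < n C k
nCk>0 {n} {k} k≤n = ≤-trans (≤-reflexive (sym (nCn≡1 k))) (C-monoˡ-≤ k k≤n)

^-distribʳ-* : ∀ o m n → (m * n) ^ o ≡ m ^ o * n ^ o
^-distribʳ-* zero    m n = refl
^-distribʳ-* (suc o) m n = trans (cong (m * n *_) (^-distribʳ-* o m n)) (interchange m n (m ^ o) (n ^ o))
  where
  interchange : ∀ m n a b → m * n * (a * b) ≡ m * a * (n * b)
  interchange = solve-∀

-- Here p is the number of vertices outside A, and p/n ≤ M′/M + 2/n. The bound (p/n)^r on the ratio
-- of binomial coefficients thereby becomes (M′/M)^r + 2r/n.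
M^r*n*pCr≤[M′^r*n+r*2*M^r]*nCr : ∀ M′ {p n} r .{{_ : NonZero n}} → let M = suc M′ in
  p ≤ n → M * p ≤ M′ * n + 2 * M →
  M ^ r * n * (p C r) ≤ (M′ ^ r * n + r * 2 * M ^ r) * (n C r)
M^r*n*pCr≤[M′^r*n+r*2*M^r]*nCr M′ {p} {n} r p≤n Mp≤ = *-cancelˡ-≤ (n ^ r) {{m^n≢0 n r}} (begin
  n ^ r * (M ^ r * n * (p C r))
    ≡⟨ regroup₁ (n ^ r) (M ^ r) n (p C r) ⟩
  M ^ r * n * ((p C r) * n ^ r)
    ≤⟨ *-monoʳ-≤ (M ^ r * n) (pCr*n^r≤p^r*nCr r p≤n) ⟩
  M ^ r * n * (p ^ r * (n C r))
    ≡⟨ regroup₂ (M ^ r) n (p ^ r) (n C r) ⟩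
  M ^ r * p ^ r * n * (n C r)
    ≡⟨ cong (λ x → x * n * (n C r)) (sym (^-distribʳ-* r M p)) ⟩
  (M * p) ^ r * n * (n C r)
    ≤⟨ *-monoˡ-≤ (n C r) (y^r*n≤x^r*n+r*c*w^r M n 2 r Mp≤ (*-monoʳ-≤ M p≤n) (*-monoˡ-≤ n (n≤1+n M′))) ⟩
  ((M′ * n) ^ r * n + r * 2 * (M * n) ^ r) * (n C r)
    ≡⟨ cong₂ (λ x y → (x * n + r * 2 * y) * (n C r)) (^-distribʳ-* r M′ n) (^-distribʳ-* r M n) ⟩
  (M′ ^ r * n ^ r * n + r * 2 * (M ^ r * n ^ r)) * (n C r)
    ≡⟨ regroup₃ (M′ ^ r) (n ^ r) n (r * 2) (M ^ r) (n C r) ⟩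
  n ^ r * ((M′ ^ r * n + r * 2 * M ^ r) * (n C r)) ∎)
  where
  open ≤-Reasoning
  M = suc M′
  regroup₁ : ∀ a b n c → a * (b * n * c) ≡ b * n * (c * a)
  regroup₁ = solve-∀
  regroup₂ : ∀ b n a c → b * n * (a * c) ≡ b * a * n * c
  regroup₂ = solve-∀
  regroup₃ : ∀ b a n s m c → (b * a * n + s * (m * a)) * c ≡ a * ((b * n + s * m) * c)
  regroup₃ = solve-∀

-- `D` will be the minimum degree. The loss dr from shrinking n to n-d and the loss 2r from rounding
-- |A| add up to the constant (d+2)r.
n*M^r*nCr≤n*M^r*D+error : ∀ M′ {p n d D} r .{{_ : NonZero n}} → let M = suc M′ in
  p ≤ n → M * p ≤ M′ * n + 2 * M → (n ∸ d) C r ≤ p C r + D →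
  n * M ^ r * (n C r) ≤ n * M ^ r * D + (M′ ^ r * n + (d + 2) * r * M ^ r) * (n C r)
n*M^r*nCr≤n*M^r*D+error M′ {p} {n} {d} {D} r p≤n Mp≤ ≤D = begin
  n * M ^ r * (n C r)
    ≡⟨ regroup₁ n (M ^ r) (n C r) ⟩
  M ^ r * (n * (n C r))
    ≤⟨ *-monoʳ-≤ (M ^ r) (n*nCr≤n*[n∸d]Cr+d*r*nCr n r d) ⟩
  M ^ r * (n * ((n ∸ d) C r) + d * r * (n C r))
    ≤⟨ *-monoʳ-≤ (M ^ r) (+-monoˡ-≤ _ (*-monoʳ-≤ n ≤D)) ⟩
  M ^ r * (n * (p C r + D) + d * r * (n C r))
    ≡⟨ regroup₂ (M ^ r) n (p C r) D (d * r) (n C r) ⟩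
  M ^ r * n * (p C r) + (n * M ^ r * D + d * r * M ^ r * (n C r))
    ≤⟨ +-monoˡ-≤ _ (M^r*n*pCr≤[M′^r*n+r*2*M^r]*nCr M′ r p≤n Mp≤) ⟩
  (M′ ^ r * n + r * 2 * M ^ r) * (n C r) + (n * M ^ r * D + d * r * M ^ r * (n C r))
    ≡⟨ regroup₃ (M′ ^ r) n r (M ^ r) (n C r) D d ⟩
  n * M ^ r * D + (M′ ^ r * n + (d + 2) * r * M ^ r) * (n C r) ∎
  where
  open ≤-Reasoning
  M = suc M′
  regroup₁ : ∀ n b c → n * b * c ≡ b * (n * c)
  regroup₁ = solve-∀
  regroup₂ : ∀ b n a D s c → b * (n * (a + D) + s * c) ≡ b * n * a + (n * b * D + s * b * c)
  regroup₂ = solve-∀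
  regroup₃ : ∀ b n r m c D d → (b * n + r * 2 * m) * c + (n * m * D + d * r * m * c)
                             ≡ n * m * D + (b * n + (d + 2) * r * m) * c
  regroup₃ = solve-∀

-- The term 2M pays one M for the floor in n/M and one for the vertex then removed, that is, n ≤
-- M(a+2). Adding n on both sides allows M(n-a) and Ma to combine to Mn.
M*[n∸a]≤M′*n+2*M : ∀ M′ n → let M = suc M′ in M * (n ∸ (n / M ∸ 1)) ≤ M′ * n + 2 * M
M*[n∸a]≤M′*n+2*M M′ n = +-cancelʳ-≤ n _ _ (begin
  M * (n ∸ a) + n                    ≤⟨ +-monoʳ-≤ (M * (n ∸ a)) n≤M[a+2] ⟩
  M * (n ∸ a) + M * (a + 2)          ≡⟨ regroup M (n ∸ a) a ⟩
  M * (n ∸ a + a) + 2 * M            ≡⟨ cong (λ x → M * x + 2 * M) (m∸n+n≡m a≤n) ⟩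
  (n + M′ * n) + 2 * M               ≡⟨ collect n (M′ * n) (2 * M) ⟩
  M′ * n + 2 * M + n                 ∎)
  where
  open ≤-Reasoning
  M = suc M′
  a = n / M ∸ 1
  a≤n : a ≤ n
  a≤n = ≤-trans (m∸n≤m (n / M) 1) (m/n≤m n M)
  regroup : ∀ M p a → M * p + M * (a + 2) ≡ M * (p + a) + 2 * M
  regroup = solve-∀
  collect : ∀ n x y → n + x + y ≡ x + y + n
  collect = solve-∀
  n≤M[a+2] : n ≤ M * (a + 2)
  n≤M[a+2] = begin
    n                           ≡⟨ m≡m%n+[m/n]*n n M ⟩
    n % M + n / M * M           ≤⟨ +-mono-≤ (m%n≤n n M) (*-monoˡ-≤ M (m≤n+m∸n (n / M) 1)) ⟩
    M + (1 + a) * M             ≡⟨ lemma M a ⟩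
    M * (a + 2)                 ∎
    where
    lemma : ∀ M a → M + (1 + a) * M ≡ M * (a + 2)
    lemma = solve-∀

-- Counting subsets

count : (X → Bool) → List X → ℕ
count P xs = length (filterᵇ P xs)

count-≤-+ : (P Q R : X → Bool) → (∀ x → T (P x) → T (Q x) ⊎ T (R x)) →
  ∀ xs → count P xs ≤ count Q xs + count R xs
count-≤-+ P Q R P⇒Q∨R [] = z≤n
count-≤-+ P Q R P⇒Q∨R (x ∷ xs) with P x | Q x | R x | P⇒Q∨R x | count-≤-+ P Q R P⇒Q∨R xs
... | true  | false | false | f | ih with f _
...   | inj₁ ()
...   | inj₂ ()
count-≤-+ P Q R P⇒Q∨R (x ∷ xs) | true  | true  | false | f | ih = s≤s ih
count-≤-+ P Q R P⇒Q∨R (x ∷ xs) | true  | false | true  | f | ih = ≤-trans (s≤s ih) (≤-reflexive (sym (+-suc _ _)))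
count-≤-+ P Q R P⇒Q∨R (x ∷ xs) | true  | true  | true  | f | ih = s≤s (≤-trans ih (+-monoʳ-≤ _ (n≤1+n _)))
count-≤-+ P Q R P⇒Q∨R (x ∷ xs) | false | true  | false | f | ih = m≤n⇒m≤1+n ih
count-≤-+ P Q R P⇒Q∨R (x ∷ xs) | false | false | true  | f | ih = ≤-trans ih (+-monoʳ-≤ _ (n≤1+n _))
count-≤-+ P Q R P⇒Q∨R (x ∷ xs) | false | true  | true  | f | ih = m≤n⇒m≤1+n (≤-trans ih (+-monoʳ-≤ _ (n≤1+n _)))
count-≤-+ P Q R P⇒Q∨R (x ∷ xs) | false | false | false | f | ih = ih

count-empty : (P : X → Bool) → (∀ x → P x ≡ false) → ∀ xs → count P xs ≡ 0
count-empty P ¬P []       = refl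
count-empty P ¬P (x ∷ xs) rewrite ¬P x = count-empty P ¬P xs

count-map : (P : Y → Bool) (f : X → Y) → ∀ xs → count P (map f xs) ≡ count (P ∘ f) xs
count-map P f [] = refl
count-map P f (x ∷ xs) with P (f x)
... | true  = cong suc (count-map P f xs)
... | false = count-map P f xs

count-++ : (P : X → Bool) → ∀ xs ys → count P (xs ++ ys) ≡ count P xs + count P ys
count-++ P []       ys = refl
count-++ P (x ∷ xs) ys with P x
... | true  = cong suc (count-++ P xs ys)
... | false = count-++ P xs ys

count-filter : (P : X → Bool) {Q : X → Set} (Q? : Decidable Q) → ∀ xs →
  count P (filter Q? xs) ≡ count (λ x → P x ∧ does (Q? x)) xs
count-filter P Q? [] = refl
count-filter P Q? (x ∷ xs) with does (Q? x)
... | false with P x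
...   | true  = count-filter P Q? xs
...   | false = count-filter P Q? xs
count-filter P Q? (x ∷ xs) | true with P x
...   | true  = cong suc (count-filter P Q? xs)
...   | false = count-filter P Q? xs

count-subsets-suc : ∀ {n} (P : Subset (suc n) → Bool) →
  count P (subsets (suc n)) ≡ count (P ∘ (outside Vec.∷_)) (subsets n)
                            + count (P ∘ (inside Vec.∷_)) (subsets n)
count-subsets-suc {n} P = begin
  count P (map (outside Vec.∷_) (subsets n) ++ map (inside Vec.∷_) (subsets n))
    ≡⟨ count-++ P (map (outside Vec.∷_) (subsets n)) _ ⟩
  count P (map (outside Vec.∷_) (subsets n)) + count P (map (inside Vec.∷_) (subsets n))
    ≡⟨ cong₂ _+_ (count-map P (outside Vec.∷_) (subsets n)) (count-map P (inside Vec.∷_) (subsets n)) ⟩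
  count (P ∘ (outside Vec.∷_)) (subsets n) + count (P ∘ (inside Vec.∷_)) (subsets n) ∎
  where open ≡-Reasoning

-- Both tests are Boolean and disjointness comes first, so that once the first entries of `S` and
-- `R` are known the predicate reduces by computation, to `false` when both are `inside`.
avoids : ∀ {n} → Subset n → ℕ → Subset n → Bool
avoids S r R = (∣ R ∩ S ∣ ≡ᵇ 0) ∧ (∣ R ∣ ≡ᵇ r)

-- A first vertex in `S` has to be left out of the counted set; a first vertex outside `S` may be
-- taken or not, which is Pascal's rule.
count-avoids : ∀ {n} (S : Subset n) r → count (avoids S r) (subsets n) ≡ (n ∸ ∣ S ∣) C r
count-avoids Vec.[] zero    = refl
count-avoids Vec.[] (suc r) = sym (0C[1+k]≡0 r)
count-avoids {suc n} (inside Vec.∷ S) r = begin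
  count (avoids (inside Vec.∷ S) r) (subsets (suc n))   ≡⟨ count-subsets-suc (avoids (inside Vec.∷ S) r) ⟩
  count (avoids S r) (subsets n) + count (λ _ → false) (subsets n)
    ≡⟨ cong₂ _+_ (count-avoids S r) (count-empty (λ _ → false) (λ _ → refl) (subsets n)) ⟩
  (n ∸ ∣ S ∣) C r + 0   ≡⟨ +-identityʳ _ ⟩
  (n ∸ ∣ S ∣) C r       ∎
  where open ≡-Reasoning
count-avoids {suc n} (outside Vec.∷ S) zero = begin
  count (avoids (outside Vec.∷ S) 0) (subsets (suc n))   ≡⟨ count-subsets-suc (avoids (outside Vec.∷ S) 0) ⟩
  count (avoids S 0) (subsets n) + count (λ R → (∣ R ∩ S ∣ ≡ᵇ 0) ∧ false) (subsets n)
    ≡⟨ cong₂ _+_ (count-avoids S 0) (count-empty _ (λ R → ∧-zeroʳ (∣ R ∩ S ∣ ≡ᵇ 0)) (subsets n)) ⟩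
  1 ∎
  where open ≡-Reasoning
count-avoids {suc n} (outside Vec.∷ S) (suc r) = begin
  count (avoids (outside Vec.∷ S) (suc r)) (subsets (suc n))   ≡⟨ count-subsets-suc (avoids (outside Vec.∷ S) (suc r)) ⟩
  count (avoids S (suc r)) (subsets n) + count (avoids S r) (subsets n)
    ≡⟨ cong₂ _+_ (count-avoids S (suc r)) (count-avoids S r) ⟩
  (n ∸ ∣ S ∣) C suc r + (n ∸ ∣ S ∣) C r   ≡⟨ +-comm ((n ∸ ∣ S ∣) C suc r) _ ⟩
  (n ∸ ∣ S ∣) C r + (n ∸ ∣ S ∣) C suc r   ≡⟨ nCk+nC[k+1]≡[n+1]C[k+1] (n ∸ ∣ S ∣) r ⟩
  suc (n ∸ ∣ S ∣) C suc r                 ≡⟨ cong (_C suc r) (sym (+-∸-assoc 1 (∣p∣≤n S))) ⟩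
  (suc n ∸ ∣ S ∣) C suc r                 ∎
  where open ≡-Reasoning

∣p∪q∣+∣p∩q∣≡∣p∣+∣q∣ : ∀ {n} (p q : Subset n) → ∣ p ∪ q ∣ + ∣ p ∩ q ∣ ≡ ∣ p ∣ + ∣ q ∣
∣p∪q∣+∣p∩q∣≡∣p∣+∣q∣ Vec.[]              Vec.[]              = refl
∣p∪q∣+∣p∩q∣≡∣p∣+∣q∣ (outside Vec.∷ p) (outside Vec.∷ q) = ∣p∪q∣+∣p∩q∣≡∣p∣+∣q∣ p q
∣p∪q∣+∣p∩q∣≡∣p∣+∣q∣ (outside Vec.∷ p) (inside  Vec.∷ q) =
  trans (cong suc (∣p∪q∣+∣p∩q∣≡∣p∣+∣q∣ p q)) (sym (+-suc _ _))
∣p∪q∣+∣p∩q∣≡∣p∣+∣q∣ (inside  Vec.∷ p) (outside Vec.∷ q) = cong suc (∣p∪q∣+∣p∩q∣≡∣p∣+∣q∣ p q)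
∣p∪q∣+∣p∩q∣≡∣p∣+∣q∣ (inside  Vec.∷ p) (inside  Vec.∷ q) =
  cong suc (trans (+-suc _ _) (trans (cong suc (∣p∪q∣+∣p∩q∣≡∣p∣+∣q∣ p q)) (sym (+-suc _ _))))

-- The graph of all k-sets meeting a fixed set, and its degrees

-- An initial segment serves as A because the number of each of its vertices is already an element
-- of `Fin a`, ready for the pigeonhole principle.
initial : ℕ → ∀ n → Subset n
initial zero    n       = ⊥
initial (suc a) zero    = Vec.[]
initial (suc a) (suc n) = inside Vec.∷ initial a n

∣initial∣ : ∀ {a n} → a ≤ n → ∣ initial a n ∣ ≡ a
∣initial∣ {n = n} z≤n = ∣⊥∣≡0 n
∣initial∣ (s≤s a≤n)   = cong suc (∣initial∣ a≤n)

∈-initial⁻ : ∀ a {n} {v : Fin n} → v ∈ initial a n → toℕ v < a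
∈-initial⁻ zero            v∈             = contradiction v∈ ∉⊥
∈-initial⁻ (suc a) {suc n} Vec.here       = z<s
∈-initial⁻ (suc a) {suc n} (Vec.there v∈) = s<s (∈-initial⁻ a v∈)

meeting : ∀ {n} k → Subset n → KGraph k n
meeting k A = record
  { edge    = λ S → (∣ S ∣ ≡ᵇ k) ∧ ⌊ nonempty? (S ∩ A) ⌋
  ; uniform = λ S e → ≡ᵇ⇒≡ ∣ S ∣ k (proj₁ (Equivalence.to T-∧ e))
  }

meeting⁻ : ∀ {n k} (A S : Subset n) → Edge (meeting k A) S → Nonempty (S ∩ A)
meeting⁻ {k = k} A S e = toWitness {a? = nonempty? (S ∩ A)} (proj₂ (Equivalence.to (T-∧ {∣ S ∣ ≡ᵇ k}) e))

meeting⁺ : ∀ {n k} (A S : Subset n) → ∣ S ∣ ≡ k → Nonempty (S ∩ A) → Edge (meeting k A) S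
meeting⁺ A S ∣S∣≡k ne = Equivalence.from T-∧ (≡⇒≡ᵇ _ _ ∣S∣≡k , fromWitness ne)

-- If R is an r-set disjoint from `S`, then R ∪ S has k elements and is an edge as soon as R itself
-- meets `A`. So among the C(n-d,r) such R, only those avoiding `A` can fail, and at most C(n-|A|,r)
-- sets do.
deg-meeting : ∀ {n k d} (A S : Subset n) → d ≤ k → ∣ S ∣ ≡ d →
  (n ∸ d) C (k ∸ d) ≤ (n ∸ ∣ A ∣) C (k ∸ d) + deg (meeting k A) S
deg-meeting {n} {k} A S d≤k refl = begin
  (n ∸ ∣ S ∣) C r                                        ≡⟨ sym (count-avoids S r) ⟩
  count (avoids S r) (subsets n)                         ≤⟨ count-≤-+ _ (avoids A r) _ cases (subsets n) ⟩
  count (avoids A r) (subsets n) + count (λ R → edge H (R ∪ S) ∧ (∣ R ∣ ≡ᵇ r)) (subsets n)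
    ≡⟨ cong₂ _+_ (count-avoids A r) (sym (count-filter (λ R → edge H (R ∪ S)) (λ R → ∣ R ∣ ≟ r) (subsets n))) ⟩
  (n ∸ ∣ A ∣) C r + deg H S                              ∎
  where
  open ≤-Reasoning
  r = k ∸ ∣ S ∣
  H = meeting k A
  cases : ∀ R → T (avoids S r R) → T (avoids A r R) ⊎ T (edge H (R ∪ S) ∧ (∣ R ∣ ≡ᵇ r))
  cases R R∥S with Equivalence.to T-∧ R∥S
  ... | R∩S≡∅ , ∣R∣≡r with nonempty? (R ∩ A)
  ... | no R∩A≡∅ = inj₁ (Equivalence.from T-∧
          (≡⇒≡ᵇ _ 0 (trans (cong ∣_∣ (Empty-unique R∩A≡∅)) (∣⊥∣≡0 n)) , ∣R∣≡r))
  ... | yes (v , v∈R∩A) = inj₂ (Equivalence.from T-∧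
          (meeting⁺ A (R ∪ S) ∣R∪S∣≡k (v , v∈) , ∣R∣≡r))
    where
    v∈ : v ∈ (R ∪ S) ∩ A
    v∈ with x∈p∩q⁻ R A v∈R∩A
    ... | v∈R , v∈A = x∈p∩q⁺ (x∈p∪q⁺ (inj₁ v∈R) , v∈A)
    ∣R∪S∣≡k : ∣ R ∪ S ∣ ≡ k
    ∣R∪S∣≡k = ≡.begin
      ∣ R ∪ S ∣                 ≡.≡⟨ sym (+-identityʳ _) ⟩
      ∣ R ∪ S ∣ + 0             ≡.≡⟨ cong (∣ R ∪ S ∣ +_) (sym (≡ᵇ⇒≡ _ 0 R∩S≡∅)) ⟩
      ∣ R ∪ S ∣ + ∣ R ∩ S ∣     ≡.≡⟨ ∣p∪q∣+∣p∩q∣≡∣p∣+∣q∣ R S ⟩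
      ∣ R ∣ + ∣ S ∣             ≡.≡⟨ cong (_+ ∣ S ∣) (≡ᵇ⇒≡ ∣ R ∣ r ∣R∣≡r) ⟩
      k ∸ ∣ S ∣ + ∣ S ∣         ≡.≡⟨ m∸n+n≡m d≤k ⟩
      k                         ≡.∎
      where module ≡ = ≡-Reasoning

δ-meeting : ∀ {n k d} (A : Subset n) → d ≤ k →
  (n ∸ d) C (k ∸ d) ≤ (n ∸ ∣ A ∣) C (k ∸ d) + δ d (meeting k A)
δ-meeting {n} {k} {d} A d≤k = begin
  (n ∸ d) C (k ∸ d)                          ≤⟨ m≤n+m∸n c c′ ⟩
  (n ∸ ∣ A ∣) C (k ∸ d) + x                  ≤⟨ +-monoʳ-≤ _ (v≤min⁺ x≤nCr degrees) ⟩
  (n ∸ ∣ A ∣) C (k ∸ d) + δ d (meeting k A)  ∎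
  where
  open ≤-Reasoning
  c = (n ∸ d) C (k ∸ d)
  c′ = (n ∸ ∣ A ∣) C (k ∸ d)
  x = c ∸ c′
  -- The minimum in `δ` also ranges over its default value, so the lower bound must hold for that as
  -- well as for the degrees.
  x≤nCr : x ≤ n C (k ∸ d)
  x≤nCr = ≤-trans (m∸n≤m c c′) (C-monoˡ-≤ (k ∸ d) (m∸n≤m n d))
  degrees : All (x ≤_) (map (deg (meeting k A)) (subsetsOfSize d n))
  degrees = All.map⁺ (All.map
    (λ {S} ∣S∣≡d → m≤n+o⇒m∸n≤o c c′ (deg-meeting A S d≤k ∣S∣≡d))
    (All.all-filter (λ S → ∣ S ∣ ≟ d) (subsets n)))

-- Arcs of a cyclic ordering

[m%n+o]%n≡[m+o]%n : ∀ m o n .{{_ : NonZero n}} → (m % n + o) % n ≡ (m + o) % n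
[m%n+o]%n≡[m+o]%n m o n = begin
  (m % n + o) % n              ≡⟨ %-distribˡ-+ (m % n) o n ⟩
  (m % n % n + o % n) % n      ≡⟨ cong (λ x → (x + o % n) % n) (m%n%n≡m%n m n) ⟩
  (m % n + o % n) % n          ≡⟨ sym (%-distribˡ-+ m o n) ⟩
  (m + o) % n                  ∎
  where open ≡-Reasoning

-- With equal remainders the order of m and o is decided by the quotients: either o ≤ m, or the
-- quotients differ by at least one and o ≥ m + n.
m<o∧o<m+n⇒m%n≢o%n : ∀ {m o n} .{{_ : NonZero n}} → m < o → o < m + n → m % n ≢ o % n
m<o∧o<m+n⇒m%n≢o%n {m} {o} {n} m<o o<m+n m%n≡o%n with o / n ≤? m / n
... | yes o/n≤m/n = <⇒≱ m<o (begin
  o                       ≡⟨ m≡m%n+[m/n]*n o n ⟩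
  o % n + (o / n) * n     ≤⟨ +-mono-≤ (≤-reflexive (sym m%n≡o%n)) (*-monoˡ-≤ n o/n≤m/n) ⟩
  m % n + (m / n) * n     ≡⟨ sym (m≡m%n+[m/n]*n m n) ⟩
  m                       ∎)
  where open ≤-Reasoning
... | no o/n≰m/n = <⇒≱ o<m+n (begin
  m + n                           ≡⟨ cong (_+ n) (m≡m%n+[m/n]*n m n) ⟩
  m % n + (m / n) * n + n         ≡⟨ trans (+-assoc (m % n) _ n) (cong (m % n +_) (+-comm _ n)) ⟩
  m % n + suc (m / n) * n         ≤⟨ +-mono-≤ (≤-reflexive m%n≡o%n) (*-monoˡ-≤ n (≰⇒> o/n≰m/n)) ⟩
  o % n + (o / n) * n             ≡⟨ sym (m≡m%n+[m/n]*n o n) ⟩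
  o                               ∎)
  where open ≤-Reasoning

toℕ-mod : ∀ m n .{{_ : NonZero n}} → toℕ (m mod n) ≡ m % n
toℕ-mod m n = toℕ-fromℕ< (m%n<n m n)

⊕-⊕ : ∀ {n} (p : Fin n) s t → (p ⊕ s) ⊕ t ≡ p ⊕ (s + t)
⊕-⊕ {suc n} p s t = toℕ-injective (begin
  toℕ ((p ⊕ s) ⊕ t)                      ≡⟨ toℕ-mod (toℕ (p ⊕ s) + t) (suc n) ⟩
  (toℕ (p ⊕ s) + t) % suc n              ≡⟨ cong (λ x → (x + t) % suc n) (toℕ-mod (toℕ p + s) (suc n)) ⟩
  ((toℕ p + s) % suc n + t) % suc n      ≡⟨ [m%n+o]%n≡[m+o]%n (toℕ p + s) t (suc n) ⟩
  (toℕ p + s + t) % suc n                ≡⟨ cong (_% suc n) (+-assoc (toℕ p) s t) ⟩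
  (toℕ p + (s + t)) % suc n              ≡⟨ sym (toℕ-mod (toℕ p + (s + t)) (suc n)) ⟩
  toℕ (p ⊕ (s + t))                      ∎)
  where open ≡-Reasoning

∈-⋃⁺ : ∀ {n} {x : Fin n} {p ps} → p ∈ₗ ps → x ∈ p → x ∈ ⋃ ps
∈-⋃⁺ (here refl)  x∈p = x∈p∪q⁺ (inj₁ x∈p)
∈-⋃⁺ (there p∈ps) x∈p = x∈p∪q⁺ (inj₂ (∈-⋃⁺ p∈ps x∈p))

∈-⋃⁻ : ∀ {n} {x : Fin n} ps → x ∈ ⋃ ps → ∃ λ p → p ∈ₗ ps × x ∈ p
∈-⋃⁻ []       x∈ = contradiction x∈ ∉⊥
∈-⋃⁻ (p ∷ ps) x∈ with x∈p∪q⁻ p (⋃ ps) x∈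
... | inj₁ x∈p = p , here refl , x∈p
... | inj₂ x∈⋃ with ∈-⋃⁻ ps x∈⋃
...   | q , q∈ps , x∈q = q , there q∈ps , x∈q

-- As an inequality this remains true when `f` repeats values, as happens for an arc longer than the
-- whole cycle.
∣⋃⁅⁆∣≤length : ∀ {n} {X : Set} (f : X → Fin n) xs → ∣ ⋃ (map (λ x → ⁅ f x ⁆) xs) ∣ ≤ length xs
∣⋃⁅⁆∣≤length {n} f []   = ≤-reflexive (∣⊥∣≡0 n)
∣⋃⁅⁆∣≤length f (x ∷ xs) = begin
  ∣ ⁅ f x ⁆ ∪ U ∣                           ≤⟨ m≤m+n _ ∣ ⁅ f x ⁆ ∩ U ∣ ⟩
  ∣ ⁅ f x ⁆ ∪ U ∣ + ∣ ⁅ f x ⁆ ∩ U ∣         ≡⟨ ∣p∪q∣+∣p∩q∣≡∣p∣+∣q∣ ⁅ f x ⁆ U ⟩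
  ∣ ⁅ f x ⁆ ∣ + ∣ U ∣                       ≤⟨ +-mono-≤ (≤-reflexive (∣⁅x⁆∣≡1 (f x))) (∣⋃⁅⁆∣≤length f xs) ⟩
  suc (length xs)                           ∎
  where
  open ≤-Reasoning
  U = ⋃ (map (λ y → ⁅ f y ⁆) xs)

module _ {n} (order : Permutation′ n) where

  ∈-arc⁺ : ∀ {k t} p → t < k → order ⟨$⟩ʳ (p ⊕ t) ∈ arc k order p
  ∈-arc⁺ {k} {t} p t<k = ∈-⋃⁺ (∈-map⁺ (λ s → ⁅ order ⟨$⟩ʳ (p ⊕ s) ⁆) (∈-upTo⁺ t<k)) (x∈⁅x⁆ _)

  ∈-arc⁻ : ∀ {k v} p → v ∈ arc k order p → ∃ λ t → t < k × v ≡ order ⟨$⟩ʳ (p ⊕ t)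
  ∈-arc⁻ {k} p v∈ with ∈-⋃⁻ (map _ (upTo k)) v∈
  ... | q , q∈ , v∈q with ∈-map⁻ (λ s → ⁅ order ⟨$⟩ʳ (p ⊕ s) ⁆) q∈
  ...   | t , t∈ , refl = t , ∈-upTo⁻ t∈ , x∈⁅y⁆⇒x≡y _ v∈q

  ∣arc∣≤k : ∀ k p → ∣ arc k order p ∣ ≤ k
  ∣arc∣≤k k p = ≤-trans (∣⋃⁅⁆∣≤length (λ t → order ⟨$⟩ʳ (p ⊕ t)) (upTo k)) (≤-reflexive (length-upTo k))

  -- Two arcs of k vertices at distance g lie in an arc of length g + k.
  k≤g+∣arc∩arc∣ : ∀ {k p q} g → p ⊕ g ≡ q → ∣ arc k order p ∣ ≡ k → ∣ arc k order q ∣ ≡ k →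
    k ≤ g + ∣ arc k order p ∩ arc k order q ∣
  k≤g+∣arc∩arc∣ {k} {p} g refl ∣P∣≡k ∣Q∣≡k = +-cancelˡ-≤ k _ _ (begin
    k + k                       ≡⟨ sym (cong₂ _+_ ∣P∣≡k ∣Q∣≡k) ⟩
    ∣ P ∣ + ∣ Q ∣               ≡⟨ sym (∣p∪q∣+∣p∩q∣≡∣p∣+∣q∣ P Q) ⟩
    ∣ P ∪ Q ∣ + ∣ P ∩ Q ∣       ≤⟨ +-monoˡ-≤ _ (≤-trans (p⊆q⇒∣p∣≤∣q∣ P∪Q⊆) (∣arc∣≤k (g + k) p)) ⟩
    g + k + ∣ P ∩ Q ∣           ≡⟨ regroup g k ∣ P ∩ Q ∣ ⟩
    k + (g + ∣ P ∩ Q ∣)         ∎)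
    where
    open ≤-Reasoning
    P = arc k order p
    Q = arc k order (p ⊕ g)
    regroup : ∀ g k x → g + k + x ≡ k + (g + x)
    regroup = solve-∀
    P∪Q⊆ : ∀ {v} → v ∈ P ∪ Q → v ∈ arc (g + k) order p
    P∪Q⊆ v∈ with x∈p∪q⁻ P Q v∈
    ... | inj₁ v∈P with ∈-arc⁻ p v∈P
    ...   | t , t<k , refl = ∈-arc⁺ p (<-≤-trans t<k (m≤n+m k g))
    P∪Q⊆ v∈ | inj₂ v∈Q with ∈-arc⁻ (p ⊕ g) v∈Q
    ...   | t , t<k , refl = subst (λ x → order ⟨$⟩ʳ x ∈ arc (g + k) order p) (sym (⊕-⊕ p g t))
                               (∈-arc⁺ p (+-monoʳ-< g t<k))

-- Before reduction modulo n, every position in the first arc is smaller than every position in the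
-- second, by less than n. Hence reduction cannot identify them, and `order` is injective.
arcs-disjoint : ∀ {n} (order : Permutation′ n) {k v} (p q : Fin n) →
  toℕ p + k ≤ toℕ q → toℕ q + k ≤ toℕ p + n → v ∈ arc k order p → ¬ v ∈ arc k order q
arcs-disjoint {suc n} order {k} p q p+k≤q q+k≤p+n v∈P v∈Q with ∈-arc⁻ order p v∈P | ∈-arc⁻ order q v∈Q
... | s , s<k , refl | t , t<k , eq = m<o∧o<m+n⇒m%n≢o%n below above (begin
  (toℕ p + s) % suc n     ≡⟨ sym (toℕ-mod (toℕ p + s) (suc n)) ⟩
  toℕ (p ⊕ s)             ≡⟨ cong toℕ (Injection.injective (↔⇒↣ order) eq) ⟩
  toℕ (q ⊕ t)             ≡⟨ toℕ-mod (toℕ q + t) (suc n) ⟩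
  (toℕ q + t) % suc n     ∎)
  where
  open ≡-Reasoning
  below : toℕ p + s < toℕ q + t
  below = <-≤-trans (+-monoʳ-< (toℕ p) s<k) (≤-trans p+k≤q (m≤m+n _ t))
  above : toℕ q + t < toℕ p + s + suc n
  above = <-≤-trans (+-monoʳ-< (toℕ q) t<k) (≤-trans q+k≤p+n (+-monoˡ-≤ (suc n) (m≤m+n (toℕ p) s)))

-- Spacing of the edges along an ℓ-cycle

module Starts {n m k ℓ} (order : Permutation′ n) (start : Fin (suc m) → Fin n)
  (increasing : ∀ {i j} → i Fin.< j → start i Fin.< start j)
  (sharing : ∀ j → ∣ arc k order (start j) ∩ arc k order (start (j ⊕ 1)) ∣ ≡ ℓ)
  (size : ∀ j → ∣ arc k order (start j) ∣ ≡ k) where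

  private instance
    n≢0 : NonZero n
    n≢0 = nonZeroIndex (start Fin.zero)

  -- Edge indices are read modulo the number `suc m` of edges: m is the index of the last edge, and
  -- `suc m` leads back to the first.
  startℕ : ℕ → Fin n
  startℕ i = start (i mod suc m)

  pos : ℕ → ℕ
  pos i = toℕ (startℕ i)

  pos-mono-≤ : ∀ {i j} → i ≤ j → j ≤ m → pos i ≤ pos j
  pos-mono-≤ {i} {j} i≤j j≤m with m≤n⇒m<n∨m≡n i≤j
  ... | inj₂ refl = ≤-refl
  ... | inj₁ i<j  = <⇒≤ (increasing (subst₂ _<_ (sym (toℕ-id (≤-trans i≤j j≤m))) (sym (toℕ-id j≤m)) i<j))
    where
    toℕ-id : ∀ {i} → i ≤ m → toℕ (i mod suc m) ≡ i
    toℕ-id {i} i≤m = trans (toℕ-mod i (suc m)) (m≤n⇒m%n≡m i≤m)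

  -- Here w is the next start with the turns of the cycle unrolled: `pos (suc i)`, or that plus n
  -- after the last edge. Arcs at distance g share at least k-g vertices; these share exactly ℓ, so
  -- g ≥ k-ℓ.
  gap : ∀ i w → pos i ≤ w → w % n ≡ pos (suc i) → pos i + (k ∸ ℓ) ≤ w
  gap i w i≤w w≡ = begin
    pos i + (k ∸ ℓ)       ≤⟨ +-monoʳ-≤ (pos i) (m≤n+o⇒m∸n≤o k ℓ (≤-trans
                              (k≤g+∣arc∩arc∣ order g (step n (startℕ i) (startℕ (suc i)) i≤w w≡) (size _) (size _))
                              (≤-reflexive (trans (cong (g +_) shared) (+-comm g ℓ))))) ⟩
    pos i + (w ∸ pos i)   ≡⟨ m+[n∸m]≡n i≤w ⟩
    w                     ∎
    where
    open ≤-Reasoning hiding (start)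
    g = w ∸ pos i
    step : ∀ n .{{_ : NonZero n}} (p q : Fin n) → toℕ p ≤ w → w % n ≡ toℕ q → p ⊕ (w ∸ toℕ p) ≡ q
    step (suc n) p q p≤w w≡q = toℕ-injective
      (trans (toℕ-mod (toℕ p + (w ∸ toℕ p)) (suc n)) (trans (cong (_% suc n) (m+[n∸m]≡n p≤w)) w≡q))
    next : (i mod suc m) ⊕ 1 ≡ suc i mod suc m
    next = toℕ-injective (trans (toℕ-mod (toℕ (i mod suc m) + 1) (suc m))
      (trans (cong (λ x → (x + 1) % suc m) (toℕ-mod i (suc m)))
      (trans ([m%n+o]%n≡[m+o]%n i 1 (suc m))
      (trans (cong (_% suc m) (+-comm i 1)) (sym (toℕ-mod (suc i) (suc m)))))))
    shared : ∣ arc k order (startℕ i) ∩ arc k order (startℕ (suc i)) ∣ ≡ ℓ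
    shared = subst (λ j → ∣ arc k order (startℕ i) ∩ arc k order (start j) ∣ ≡ ℓ) next (sharing (i mod suc m))

  gap-inner : ∀ i → i < m → pos i + (k ∸ ℓ) ≤ pos (suc i)
  gap-inner i i<m = gap i (pos (suc i)) (pos-mono-≤ (n≤1+n i) i<m) (m<n⇒m%n≡m (toℕ<n (startℕ (suc i))))

  gap-last : pos m + (k ∸ ℓ) ≤ pos 0 + n
  gap-last = gap m (pos 0 + n) (≤-trans (<⇒≤ (toℕ<n (startℕ m))) (m≤n+m n (pos 0)))
    (trans ([m+n]%n≡m%n (pos 0) n)
    (trans (m<n⇒m%n≡m (toℕ<n (startℕ 0)))
    (cong (toℕ ∘ start) (toℕ-injective (trans (toℕ-mod 0 (suc m))
      (trans (sym (n%n≡0 (suc m))) (sym (toℕ-mod (suc m) (suc m)))))))))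

  -- Two gaps add up to 2(k-ℓ) ≥ k. The second inequality goes round the other way; `2 * j < m`
  -- ensures that edge 2j+1 still comes before the turn, so that two gaps are available there too.
  even-starts-apart : ∀ i j → i < j → 2 * j < m → k ≤ 2 * (k ∸ ℓ) →
    pos (2 * i) + k ≤ pos (2 * j) × pos (2 * j) + k ≤ pos (2 * i) + n
  even-starts-apart i j i<j 2j<m k≤2c = before , after
    where
    open ≤-Reasoning hiding (start)
    c = k ∸ ℓ
    double : ∀ x c → x + 2 * c ≡ x + c + c
    double = solve-∀
    2i+2≤2j : 2 + 2 * i ≤ 2 * j
    2i+2≤2j = ≤-trans (≤-reflexive (sym (*-suc 2 i))) (*-monoʳ-≤ 2 i<j)
    before = begin
      pos (2 * i) + k              ≤⟨ +-monoʳ-≤ (pos (2 * i)) k≤2c ⟩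
      pos (2 * i) + 2 * c          ≡⟨ double (pos (2 * i)) c ⟩
      pos (2 * i) + c + c          ≤⟨ +-monoˡ-≤ c (gap-inner (2 * i) (≤-trans (n≤1+n _) (≤-trans 2i+2≤2j (<⇒≤ 2j<m)))) ⟩
      pos (1 + 2 * i) + c          ≤⟨ gap-inner (1 + 2 * i) (≤-trans 2i+2≤2j (<⇒≤ 2j<m)) ⟩
      pos (2 + 2 * i)              ≤⟨ pos-mono-≤ 2i+2≤2j (<⇒≤ 2j<m) ⟩
      pos (2 * j)                  ∎
    after = begin
      pos (2 * j) + k              ≤⟨ +-monoʳ-≤ (pos (2 * j)) k≤2c ⟩
      pos (2 * j) + 2 * c          ≡⟨ double (pos (2 * j)) c ⟩
      pos (2 * j) + c + c          ≤⟨ +-monoˡ-≤ c (gap-inner (2 * j) 2j<m) ⟩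
      pos (1 + 2 * j) + c          ≤⟨ +-monoˡ-≤ c (pos-mono-≤ 2j<m ≤-refl) ⟩
      pos m + c                    ≤⟨ gap-last ⟩
      pos 0 + n                    ≤⟨ +-monoˡ-≤ n (pos-mono-≤ z≤n (≤-trans (*-monoʳ-≤ 2 (<⇒≤ i<j)) (<⇒≤ 2j<m))) ⟩
      pos (2 * i) + n              ∎

  -- The first a + 1 arcs of even index are pairwise disjoint, so they cannot all
  -- meet the a first vertices.
  even-arcs-meet-initial : ∀ a → k ≤ 2 * (k ∸ ℓ) →
    (∀ j → 0 < j → j ≤ a → 2 * j < m) →
    ¬ (∀ j → Nonempty (arc k order (start j) ∩ initial a n))
  even-arcs-meet-initial a k≤2c few meets with pigeonhole (n<1+n a) hit
    where
    -- Each even arc is sent to a vertex of A lying on it; two arcs with the same image would share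
    -- that vertex.
    hit : Fin (suc a) → Fin a
    hit i = fromℕ< (∈-initial⁻ a (p∩q⊆q _ (initial a n) (proj₂ (meets (2 * toℕ i mod suc m)))))
  ... | i , j , i<j , hit-i≡hit-j
    with even-starts-apart (toℕ i) (toℕ j) i<j
           (few (toℕ j) (≤-<-trans z≤n i<j) (s≤s⁻¹ (toℕ<n j))) k≤2c
  ... | before , after = arcs-disjoint order _ _ before after (on-arc (toℕ i))
          (subst (_∈ arc k order (startℕ (2 * toℕ j))) (sym vᵢ≡vⱼ) (on-arc (toℕ j)))
    where
    v : ℕ → Fin n
    v i = proj₁ (meets (2 * i mod suc m))
    on-arc : ∀ i → v i ∈ arc k order (startℕ (2 * i))
    on-arc i = p∩q⊆p _ (initial a n) (proj₂ (meets (2 * i mod suc m)))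
    vᵢ≡vⱼ : v (toℕ i) ≡ v (toℕ j)
    vᵢ≡vⱼ = toℕ-injective (trans (sym (toℕ-fromℕ< _)) (trans (cong toℕ hit-i≡hit-j) (toℕ-fromℕ< _)))

consecutive-arcs-miss-initial : ∀ {k ℓ n m} .{{_ : NonZero (2 * (k ∸ ℓ))}} → k ≤ 2 * (k ∸ ℓ) →
  let A = initial (n / (2 * (k ∸ ℓ)) ∸ 1) n in
  (order : Permutation′ n) (start : Fin m → Fin n) → 0 < m → m * (k ∸ ℓ) ≡ n →
  (∀ {i j} → i Fin.< j → start i Fin.< start j) →
  (∀ j → ∣ arc k order (start j) ∩ arc k order (start (j ⊕ 1)) ∣ ≡ ℓ) →
  ¬ (∀ j → Edge (meeting k A) (arc k order (start j)))
consecutive-arcs-miss-initial {k} {ℓ} {n} {suc m} k≤2c order start _ mc≡n increasing sharing isEdge =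
  even-arcs-meet-initial a k≤2c few (λ j → meeting⁻ A _ (isEdge j))
  where
  a = n / (2 * (k ∸ ℓ)) ∸ 1
  A = initial a n
  open Starts order start increasing sharing (λ j → uniform (meeting k A) _ (isEdge j))
  -- From 0 < j ≤ q ∸ 1 it follows that q ≥ j+1, even though the subtraction is truncated; j = 0
  -- would break this when q = 0. Then (2j+2)c ≤ n = (m+1)c, which leaves room for edge 2j+1.
  few : ∀ j → 0 < j → j ≤ a → 2 * j < m
  few j 0<j j≤a = s≤s⁻¹ (*-cancelʳ-≤ (2 + 2 * j) (suc m) c {{m*n≢0⇒n≢0 2}} (begin
    (2 + 2 * j) * c           ≡⟨ regroup j c ⟩
    (j + 1) * (2 * c)         ≤⟨ *-monoˡ-≤ (2 * c) (j+1≤q (n / (2 * c)) 0<j j≤a) ⟩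
    n / (2 * c) * (2 * c)     ≤⟨ m/n*n≤m n (2 * c) ⟩
    n                         ≡⟨ sym mc≡n ⟩
    suc m * c                 ∎))
    where
    open ≤-Reasoning hiding (start)
    c = k ∸ ℓ
    regroup : ∀ j c → (2 + 2 * j) * c ≡ (j + 1) * (2 * c)
    regroup = solve-∀
    j+1≤q : ∀ {j} q → 0 < j → j ≤ q ∸ 1 → j + 1 ≤ q
    j+1≤q zero    0<j j≤0 = contradiction (<-≤-trans 0<j j≤0) λ()
    j+1≤q {j} (suc q) 0<j j≤q = subst (_≤ suc q) (+-comm 1 j) (s≤s j≤q)

meeting-initial-has-no-Hamilton-cycle : ∀ k ℓ n .{{_ : NonZero (2 * (k ∸ ℓ))}} → k ≤ 2 * (k ∸ ℓ) →
  ¬ HasHamiltonCycle ℓ (meeting k (initial (n / (2 * (k ∸ ℓ)) ∸ 1) n))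
meeting-initial-has-no-Hamilton-cycle k ℓ n k≤2c (G , C , G⊆H) =
  consecutive-arcs-miss-initial k≤2c order start nonempty edgeCount increasing sharing
    (λ j → G⊆H _ (Equivalence.from (edges _) (j , refl)))
  where open IsCycle C

-- Rational numbers

-- `ratio` normalises its fraction. Passing to unnormalised rationals turns the equations and
-- inequalities below into integer cross-multiplications.
toℚᵘ-ratio : ∀ a b → toℚᵘ (ratio a (suc b)) ℚᵘ.≃ mkℚᵘ (ℤ.+ a) b
toℚᵘ-ratio a b = ℚ.toℚᵘ-fromℚᵘ (mkℚᵘ (ℤ.+ a) b)

fromℕ-+ : ∀ a b → fromℕ (a + b) ≡ fromℕ a ℚ.+ fromℕ b
fromℕ-+ a b = ℚ.toℚᵘ-injective (begin
  toℚᵘ (fromℕ (a + b))                     ≈⟨ toℚᵘ-ratio (a + b) 0 ⟩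
  mkℚᵘ (ℤ.+ (a + b)) 0                       ≈⟨ *≡* (cong₂ (λ x y → (x ℤ.+ y) ℤ.* (ℤ.+ 1))
                                                     (sym (ℤ.*-identityʳ (ℤ.+ a))) (sym (ℤ.*-identityʳ (ℤ.+ b)))) ⟩
  mkℚᵘ (ℤ.+ a) 0 ℚᵘ.+ mkℚᵘ (ℤ.+ b) 0           ≈⟨ ℚᵘ.+-cong (ℚᵘ.≃-sym (toℚᵘ-ratio a 0)) (ℚᵘ.≃-sym (toℚᵘ-ratio b 0)) ⟩
  toℚᵘ (fromℕ a) ℚᵘ.+ toℚᵘ (fromℕ b)       ≈⟨ ℚᵘ.≃-sym (ℚ.toℚᵘ-homo-+ (fromℕ a) (fromℕ b)) ⟩
  toℚᵘ (fromℕ a ℚ.+ fromℕ b)               ∎)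
  where open ℚᵘ.≃-Reasoning

ratio-* : ∀ a b c → ratio a (suc b) ℚ.* fromℕ c ≡ ratio (a * c) (suc b)
ratio-* a b c = ℚ.toℚᵘ-injective (begin
  toℚᵘ (ratio a (suc b) ℚ.* fromℕ c)           ≈⟨ ℚ.toℚᵘ-homo-* (ratio a (suc b)) (fromℕ c) ⟩
  toℚᵘ (ratio a (suc b)) ℚᵘ.* toℚᵘ (fromℕ c)   ≈⟨ ℚᵘ.*-cong (toℚᵘ-ratio a b) (toℚᵘ-ratio c 0) ⟩
  mkℚᵘ (ℤ.+ a) b ℚᵘ.* mkℚᵘ (ℤ.+ c) 0               ≈⟨ *≡* (cong₂ (λ x y → x ℤ.* (ℤ.+ y)) (sym (ℤ.pos-* a c)) (sym (*-identityʳ (suc b)))) ⟩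
  mkℚᵘ (ℤ.+ (a * c)) b                           ≈⟨ ℚᵘ.≃-sym (toℚᵘ-ratio (a * c) b) ⟩
  toℚᵘ (ratio (a * c) (suc b))                 ∎)
  where open ℚᵘ.≃-Reasoning

fromℕ-* : ∀ a b → fromℕ (a * b) ≡ fromℕ a ℚ.* fromℕ b
fromℕ-* a b = sym (ratio-* a 0 b)

ratio-*-cancel : ∀ a b .{{_ : NonZero b}} → ratio a b ℚ.* fromℕ b ≡ fromℕ a
ratio-*-cancel a (suc b) = trans (ratio-* a b (suc b)) (ℚ.toℚᵘ-injective (begin
  toℚᵘ (ratio (a * suc b) (suc b))    ≈⟨ toℚᵘ-ratio (a * suc b) b ⟩
  mkℚᵘ (ℤ.+ (a * suc b)) b              ≈⟨ *≡* (trans (ℤ.*-identityʳ _) (ℤ.pos-* a (suc b))) ⟩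
  mkℚᵘ (ℤ.+ a) 0                        ≈⟨ ℚᵘ.≃-sym (toℚᵘ-ratio a 0) ⟩
  toℚᵘ (fromℕ a)                      ∎))
  where open ℚᵘ.≃-Reasoning

fromℕ-mono-≤ : ∀ {a b} → a ≤ b → fromℕ a ℚ.≤ fromℕ b
fromℕ-mono-≤ {a} {b} a≤b = ℚ.toℚᵘ-cancel-≤ (ℚᵘ.≤-respˡ-≃ (ℚᵘ.≃-sym (toℚᵘ-ratio a 0))
  (ℚᵘ.≤-respʳ-≃ (ℚᵘ.≃-sym (toℚᵘ-ratio b 0))
  (*≤* (ℤ.*-monoʳ-≤-nonNeg (ℤ.+ 1) (ℤ.+≤+ a≤b)))))

fromℕ-pos : ∀ a .{{_ : NonZero a}} → ℚ.Positive (fromℕ a)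
fromℕ-pos (suc a) = ℚ.normalize-pos (suc a) 1

0≤ratio : ∀ a b → 0ℚ ℚ.≤ ratio a b
0≤ratio a zero    = ℚ.≤-refl
0≤ratio a (suc b) = ℚ.nonNegative⁻¹ (ratio a (suc b)) {{ℚ.normalize-nonNeg a (suc b)}}

ratio-eventually-< : ∀ a ε → 0ℚ ℚ.< ε → ∃ λ N → ∀ n → N ≤ n → ratio a n ℚ.< ε
ratio-eventually-< a (mkℚ (ℤ.+ zero) q _)       (ℚ.*<* (ℤ.+<+ ()))
ratio-eventually-< a (mkℚ (ℤ.-[1+ _ ]) q _)   (ℚ.*<* ())
-- For ε = (1+p)/(1+q), the claim a/n < ε means a(1+q) < (1+p)n, and n > a(1+q) is enough.
ratio-eventually-< a ε@(mkℚ (ℤ.+ suc p) q _)    _ = suc (a * suc q) , small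
  where
  small : ∀ n → suc (a * suc q) ≤ n → ratio a n ℚ.< ε
  small (suc n) N≤n = ℚ.toℚᵘ-cancel-< (ℚᵘ.<-respˡ-≃ (ℚᵘ.≃-sym (toℚᵘ-ratio a n))
    (*<* (subst₂ ℤ._<_ (ℤ.pos-* a (suc q)) (ℤ.pos-* (suc p) (suc n))
      (ℤ.+<+ (≤-trans N≤n (m≤n*m (suc n) (suc p)))))))

ratio-tendsToZero : ∀ a → TendsToZero (ratio a)
ratio-tendsToZero a ε 0<ε with ratio-eventually-< a ε 0<ε
... | N , small = N , λ n N≤n → subst (ℚ._< ε) (sym (ℚ.0≤p⇒∣p∣≡p (0≤ratio a n))) (small n N≤n)

[1-1/M]^r*M^r≡M′^r : ∀ M′ r → let M = suc M′ in
  (1ℚ ℚ.- ratio 1 M) Defs.^ r ℚ.* fromℕ (M ^ r) ≡ fromℕ (M′ ^ r)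
[1-1/M]^r*M^r≡M′^r M′ zero    = refl
[1-1/M]^r*M^r≡M′^r M′ (suc r) = begin
  x ℚ.* x Defs.^ r ℚ.* fromℕ (M * M ^ r)
    ≡⟨ cong (x ℚ.* x Defs.^ r ℚ.*_) (fromℕ-* M (M ^ r)) ⟩
  x ℚ.* x Defs.^ r ℚ.* (fromℕ M ℚ.* fromℕ (M ^ r))
    ≡⟨ interchange x (x Defs.^ r) (fromℕ M) (fromℕ (M ^ r)) ⟩
  (x ℚ.* fromℕ M) ℚ.* (x Defs.^ r ℚ.* fromℕ (M ^ r))
    ≡⟨ cong₂ ℚ._*_ x*M≡M′ ([1-1/M]^r*M^r≡M′^r M′ r) ⟩
  fromℕ M′ ℚ.* fromℕ (M′ ^ r)
    ≡⟨ sym (fromℕ-* M′ (M′ ^ r)) ⟩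
  fromℕ (M′ * M′ ^ r) ∎
  where
  open ≡-Reasoning
  open +-*-Solver
  M = suc M′
  x = 1ℚ ℚ.- ratio 1 M
  interchange : ∀ a b c d → a ℚ.* b ℚ.* (c ℚ.* d) ≡ (a ℚ.* c) ℚ.* (b ℚ.* d)
  interchange = solve 4 (λ a b c d → a :* b :* (c :* d) := (a :* c) :* (b :* d)) refl
  expand : ∀ q m → (1ℚ ℚ.- q) ℚ.* m ≡ m ℚ.- q ℚ.* m
  expand = solve 2 (λ q m → (con 1ℚ :- q) :* m := m :- q :* m) refl
  cancel : ∀ m → 1ℚ ℚ.+ m ℚ.- 1ℚ ≡ m
  cancel = solve 1 (λ m → con 1ℚ :+ m :- con 1ℚ := m) refl
  x*M≡M′ : x ℚ.* fromℕ M ≡ fromℕ M′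
  x*M≡M′ = begin
    x ℚ.* fromℕ M                              ≡⟨ expand (ratio 1 M) (fromℕ M) ⟩
    fromℕ M ℚ.- ratio 1 M ℚ.* fromℕ M          ≡⟨ cong₂ ℚ._-_ (fromℕ-+ 1 M′) (ratio-*-cancel 1 M) ⟩
    1ℚ ℚ.+ fromℕ M′ ℚ.- 1ℚ                     ≡⟨ cancel (fromℕ M′) ⟩
    fromℕ M′                                   ∎

-- Division of the hypothesis by n M^r: the error terms M′^r n and K M^r turn into (1-1/M)^r and
-- K/n.
[1-[1-1/M]^r-K/n]*c≤D : ∀ M′ {n} K r c D .{{_ : NonZero n}} → let M = suc M′ in
  n * M ^ r * c ≤ n * M ^ r * D + (M′ ^ r * n + K * M ^ r) * c →
  (1ℚ ℚ.- (1ℚ ℚ.- ratio 1 M) Defs.^ r ℚ.- ratio K n) ℚ.* fromℕ c ℚ.≤ fromℕ D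
[1-[1-1/M]^r-K/n]*c≤D M′ {n} K r c D ≤ℕ = ℚ.*-cancelʳ-≤-pos (N ℚ.* m) {{nm-pos}} (begin
  (1ℚ ℚ.- ξ ℚ.- κ) ℚ.* fromℕ c ℚ.* (N ℚ.* m)
    ≡⟨ expand ξ κ (fromℕ c) N m ⟩
  N ℚ.* m ℚ.* fromℕ c ℚ.- ((ξ ℚ.* m) ℚ.* N ℚ.+ (κ ℚ.* N) ℚ.* m) ℚ.* fromℕ c
    ≡⟨ cong₂ (λ u v → N ℚ.* m ℚ.* fromℕ c ℚ.- (u ℚ.* N ℚ.+ v ℚ.* m) ℚ.* fromℕ c)
         ([1-1/M]^r*M^r≡M′^r M′ r) (ratio-*-cancel K n) ⟩
  N ℚ.* m ℚ.* fromℕ c ℚ.- e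
    ≤⟨ ℚ.+-monoˡ-≤ (ℚ.- e) ≤ℚ ⟩
  N ℚ.* m ℚ.* fromℕ D ℚ.+ e ℚ.- e
    ≡⟨ cancel N m (fromℕ D) e ⟩
  fromℕ D ℚ.* (N ℚ.* m) ∎)
  where
  open ℚ.≤-Reasoning
  open +-*-Solver
  M = suc M′
  ξ = (1ℚ ℚ.- ratio 1 M) Defs.^ r
  κ = ratio K n
  N = fromℕ n
  m = fromℕ (M ^ r)
  e = (fromℕ (M′ ^ r) ℚ.* N ℚ.+ fromℕ K ℚ.* m) ℚ.* fromℕ c
  nm-pos : ℚ.Positive (N ℚ.* m)
  nm-pos = ℚ.pos*pos⇒pos N {{fromℕ-pos n}} m {{fromℕ-pos (M ^ r) {{m^n≢0 M r}}}}
  expand : ∀ ξ κ c N m → (1ℚ ℚ.- ξ ℚ.- κ) ℚ.* c ℚ.* (N ℚ.* m)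
         ≡ N ℚ.* m ℚ.* c ℚ.- ((ξ ℚ.* m) ℚ.* N ℚ.+ (κ ℚ.* N) ℚ.* m) ℚ.* c
  expand = solve 5 (λ ξ κ c N m → (con 1ℚ :- ξ :- κ) :* c :* (N :* m)
         := N :* m :* c :- ((ξ :* m) :* N :+ (κ :* N) :* m) :* c) refl
  cancel : ∀ N m D e → N ℚ.* m ℚ.* D ℚ.+ e ℚ.- e ≡ D ℚ.* (N ℚ.* m)
  cancel = solve 4 (λ N m D e → N :* m :* D :+ e :- e := D :* (N :* m)) refl
  push : ∀ x → fromℕ (n * M ^ r * x) ≡ N ℚ.* m ℚ.* fromℕ x
  push x = trans (fromℕ-* (n * M ^ r) x) (cong (ℚ._* fromℕ x) (fromℕ-* n (M ^ r)))
  push-e : fromℕ ((M′ ^ r * n + K * M ^ r) * c) ≡ e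
  push-e = trans (fromℕ-* (M′ ^ r * n + K * M ^ r) c) (cong (ℚ._* fromℕ c)
    (trans (fromℕ-+ (M′ ^ r * n) (K * M ^ r)) (cong₂ ℚ._+_ (fromℕ-* (M′ ^ r) n) (fromℕ-* K (M ^ r)))))
  ≤ℚ : N ℚ.* m ℚ.* fromℕ c ℚ.≤ N ℚ.* m ℚ.* fromℕ D ℚ.+ e
  ≤ℚ = subst₂ ℚ._≤_ (push c) (trans (fromℕ-+ (n * M ^ r * D) ((M′ ^ r * n + K * M ^ r) * c))
         (cong₂ ℚ._+_ (push D) push-e))
         (fromℕ-mono-≤ ≤ℕ)

-- Density of the construction and the limsup

δ-meeting-initial : ∀ M {n k d} .{{_ : NonZero M}} → d < k → let r = k ∸ d in
  (1ℚ ℚ.- (1ℚ ℚ.- ratio 1 M) Defs.^ r ℚ.- ratio ((d + 2) * r) n) ℚ.* fromℕ (n C r)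
    ℚ.≤ fromℕ (δ d (meeting k (initial (n / M ∸ 1) n)))
-- Without vertices there is no dividing by n; but r ≥ 1 makes `0 C r` vanish, so the left side is
-- 0.
δ-meeting-initial M@(suc _) {zero} {k} {d} d<k = ℚ.≤-trans
  (ℚ.≤-reflexive (trans (cong (λ c → x ℚ.* fromℕ c) (k>n⇒nCk≡0 {0} {k ∸ d} (m<n⇒0<n∸m d<k))) (ℚ.*-zeroʳ x)))
  (fromℕ-mono-≤ {0} {δ d (meeting k (initial 0 0))} z≤n)
  where x = 1ℚ ℚ.- (1ℚ ℚ.- ratio 1 M) Defs.^ (k ∸ d) ℚ.- 0ℚ
δ-meeting-initial M@(suc M′) {n@(suc _)} {k} {d} d<k =
  [1-[1-1/M]^r-K/n]*c≤D M′ ((d + 2) * r) r (n C r) (δ d H)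
    (n*M^r*nCr≤n*M^r*D+error M′ {n ∸ a} {n} {d} {δ d H} r (m∸n≤m n a) (M*[n∸a]≤M′*n+2*M M′ n)
      (subst (λ x → (n ∸ d) C r ≤ (n ∸ x) C r + δ d H)
        (∣initial∣ (≤-trans (m∸n≤m (n / M) 1) (m/n≤m n M)))
        (δ-meeting (initial a n) (<⇒≤ d<k))))
  where
  a = n / M ∸ 1
  r = k ∸ d
  H = meeting k (initial a n)

proposition1p9 : ∀ (k ℓ d : ℕ) → 3 ≤ k → 1 ≤ ℓ → 2 * ℓ < k → 1 ≤ d → d ≤ k ∸ 1 →
    (Σ (ℕ → ℚ) λ o → TendsToZero o ×
    (∀ n → (k ∸ ℓ) ∣ n →
    Σ (KGraph k n) λ H₀ →
    ((bound k ℓ d ℚ.- o n) ℚ.* fromℕ (n C (k ∸ d))) ℚ.≤ fromℕ (δ d H₀)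
    × ¬ HasHamiltonCycle ℓ H₀))
    × (∀ (h : ℕ → ℕ) → (∀ n → (k ∸ ℓ) ∣ n → IsThreshold k ℓ d n (h n)) →
    LimsupAtLeast (λ n → (k ∸ ℓ) ∣ n) (λ n → ratio (h n) (n C (k ∸ d))) (bound k ℓ d))
proposition1p9 k ℓ d 3≤k _ 2ℓ<k _ d≤k-1 =
  (ratio K , ratio-tendsToZero K , λ n _ → H₀ n , dense n , not-hamiltonian n) , limsup
  where
  c = k ∸ ℓ
  r = k ∸ d
  K = (d + 2) * r

  ℓ<k : ℓ < k
  ℓ<k = ≤-<-trans (m≤m+n ℓ _) 2ℓ<k

  d<k : d < k
  d<k = m≤pred[n]⇒suc[m]≤n {{>-nonZero (≤-trans z<s 3≤k)}} d≤k-1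

  k≤2c : k ≤ 2 * c
  k≤2c = begin
    k                  ≡⟨ sym (m+n∸n≡m k k) ⟩
    k + k ∸ k          ≤⟨ ∸-monoʳ-≤ (k + k) (<⇒≤ 2ℓ<k) ⟩
    k + k ∸ 2 * ℓ      ≡⟨ cong (λ x → k + x ∸ 2 * ℓ) (sym (+-identityʳ k)) ⟩
    2 * k ∸ 2 * ℓ      ≡⟨ sym (*-distribˡ-∸ 2 k ℓ) ⟩
    2 * c              ∎
    where open ≤-Reasoning

  instance
    c≢0 : NonZero c
    c≢0 = >-nonZero (m<n⇒0<n∸m ℓ<k)

    2c≢0 : NonZero (2 * c)
    2c≢0 = m*n≢0 2 c

  H₀ : ∀ n → KGraph k n
  H₀ n = meeting k (initial (n / (2 * c) ∸ 1) n)

  dense : ∀ n → (bound k ℓ d ℚ.- ratio K n) ℚ.* fromℕ (n C r) ℚ.≤ fromℕ (δ d (H₀ n))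
  dense n = δ-meeting-initial (2 * c) d<k

  not-hamiltonian : ∀ n → ¬ HasHamiltonCycle ℓ (H₀ n)
  not-hamiltonian n = meeting-initial-has-no-Hamilton-cycle k ℓ n k≤2c

  limsup : ∀ h → (∀ n → c ∣ n → IsThreshold k ℓ d n (h n)) →
    LimsupAtLeast (c ∣_) (λ n → ratio (h n) (n C r)) (bound k ℓ d)
  limsup h threshold N ε 0<ε with ratio-eventually-< K ε 0<ε
  ... | N′ , small = n , N≤n , c∣n , (begin-strict
    bound k ℓ d ℚ.- ε              <⟨ ℚ.+-monoʳ-< (bound k ℓ d) (ℚ.neg-antimono-< (small n N′≤n)) ⟩
    bound k ℓ d ℚ.- ratio K n      ≤⟨ ℚ.*-cancelʳ-≤-pos (fromℕ (n C r)) {{fromℕ-pos (n C r)}} scaled ⟩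
    ratio (h n) (n C r)            ∎)
    where
    open ℚ.≤-Reasoning
    -- A multiple of c beyond both N and `N′`; the summand k gives n ≥ r, so that the denominator
    -- `n C r` is positive.
    n = (N + N′ + k) * c
    sum≤n : N + N′ + k ≤ n
    sum≤n = m≤m*n (N + N′ + k) c
    N≤n : N ≤ n
    N≤n = ≤-trans (≤-trans (m≤m+n N N′) (m≤m+n (N + N′) k)) sum≤n
    N′≤n : N′ ≤ n
    N′≤n = ≤-trans (≤-trans (m≤n+m N′ N) (m≤m+n (N + N′) k)) sum≤n
    c∣n : c ∣ n
    c∣n = divides (N + N′ + k) refl
    instance
      nCr≢0 : NonZero (n C r)
      nCr≢0 = >-nonZero (nCk>0 (≤-trans (m∸n≤m k d) (≤-trans (m≤n+m k (N + N′)) sum≤n)))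
    -- If h n were at most the minimum degree of H₀, the threshold property would force a Hamilton
    -- cycle in H₀.
    δ≤h : δ d (H₀ n) ≤ h n
    δ≤h = <⇒≤ (≰⇒> λ h≤δ → not-hamiltonian n (proj₁ (threshold n c∣n) (H₀ n) h≤δ))
    scaled : (bound k ℓ d ℚ.- ratio K n) ℚ.* fromℕ (n C r) ℚ.≤ ratio (h n) (n C r) ℚ.* fromℕ (n C r)
    scaled = ℚ.≤-trans (dense n) (ℚ.≤-trans (fromℕ-mono-≤ δ≤h)
      (ℚ.≤-reflexive (sym (ratio-*-cancel (h n) (n C r)))))
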